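{- Let $G$ be a group, let $S$ be a subgroup of $G$ such that the index $|G:S|$ is infinite, and let $X=G/S$ be the space of left cosets of $S$ in $G$, with $G$ acting by left multiplication. Then every free ultrafilter on $X$ is $G$-selective if and only if, for each subgroup $T$ of $G$ such that $S\subset T\subset G$, either $|T:S|$ is finite or $|G:T|$ is finite.
   Context: $|T:S|$ denotes the index of $S$ in $T$. A partition $\mathcal{P}$ of a $G$-space $X$ is $G$-invariant if $gP\in\mathcal{P}$ for all $g\in G$ and $P\in\mathcal{P}$. An ultrafilter is free if it is non-principal. A free ultrafilter $\mathcal{U}$ on an infinite transitive $G$-space $X$ is $G$-selective if, for every $G$-invariant partition $\mathcal{P}$ of $X$, either some cell of $\mathcal{P}$ is a member of $\mathcal{U}$, or there exists $U\in\mathcal{U}$ such that $|P\cap U|\leqslant 1$ for each $P\in\mathcal{P}$. -}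

module Defs where

open import Level using (Level; _⊔_; suc)
open import Algebra.Bundles using (Group)
import Algebra.Properties.Group as GroupProperties
open import Data.Fin.Base using (Fin)
open import Data.Product.Base using (Σ; ∃-syntax; Σ-syntax; _×_; _,_; proj₁)
open import Data.Sum.Base using (_⊎_)
open import Function.Bundles using (Func; Surjection; Inverse; _⇔_)
open import Relation.Binary.Bundles using (Setoid)
open import Relation.Binary.Definitions using (_Respects_)
import Relation.Binary.Construct.On as On
import Relation.Binary.PropositionalEquality as ≡
import Relation.Binary.Reasoning.Setoid as SetoidReasoning
open import Relation.Nullary.Negation using (¬_)
open import Relation.Unary using (Pred)

private
  variable
    a b c ℓ ℓ₁ ℓ₂ p q r x : Level

-- The axiom of choice: every surjection has a section.  The section must
-- respect the setoid equality, so this does not follow from the type-theoretic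
-- choice given by Σ-types.
Choice : ∀ a ℓ₁ b ℓ₂ → Set (suc (a ⊔ ℓ₁ ⊔ b ⊔ ℓ₂))
Choice a ℓ₁ b ℓ₂ =
  (A : Setoid a ℓ₁) (B : Setoid b ℓ₂) (f : Surjection A B) →
  Σ[ g ∈ Func B A ] (∀ y → Setoid._≈_ B (Surjection.to f (Func.to g y)) y)

Finite : Setoid a ℓ → Set (a ⊔ ℓ)
Finite A = ∃[ n ] Inverse (≡.setoid (Fin n)) A

Infinite : Setoid a ℓ → Set (a ⊔ ℓ)
Infinite A = ¬ Finite A

-- The level x ⊔ r is large enough for subsets to be closed under images.
record Subset (X : Setoid x r) : Set (suc (x ⊔ r)) where
  open Setoid X
  field
    mem  : Pred Carrier (x ⊔ r)
    resp : mem Respects _≈_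

module _ {X : Setoid x r} where
  open Setoid X
  open Subset

  infix 4 _∈_ _⊆_ _≐_
  infixr 7 _∩_

  _∈_ : Carrier → Subset X → Set (x ⊔ r)
  y ∈ A = mem A y

  _⊆_ : Subset X → Subset X → Set (x ⊔ r)
  A ⊆ B = ∀ {y} → y ∈ A → y ∈ B

  _≐_ : Subset X → Subset X → Set (x ⊔ r)
  A ≐ B = A ⊆ B × B ⊆ A

  Nonempty : Subset X → Set (x ⊔ r)
  Nonempty A = ∃[ y ] y ∈ A

  AtMostOne : Subset X → Set (x ⊔ r)
  AtMostOne A = ∀ {y z} → y ∈ A → z ∈ A → y ≈ z

  _∩_ : Subset X → Subset X → Subset X
  A ∩ B = record
    { mem  = λ y → y ∈ A × y ∈ B
    ; resp = λ y≈z (y∈A , y∈B) → resp A y≈z y∈A , resp B y≈z y∈B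
    }

  ∁ : Subset X → Subset X
  ∁ A = record
    { mem  = λ y → ¬ (y ∈ A)
    ; resp = λ y≈z y∉A z∈A → y∉A (resp A (sym y≈z) z∈A)
    }

image : {X : Setoid x r} → Func X X → Subset X → Subset X
image {X = X} f A = record
  { mem  = λ z → ∃[ y ] (y ∈ A × z ≈ to y)
  ; resp = λ z≈w (y , y∈A , z≈fy) → y , y∈A , trans (sym z≈w) z≈fy
  }
  where
  open Setoid X
  open Func f using (to)

Family : Setoid x r → Set (suc (x ⊔ r))
Family {x} {r} X = Pred (Subset X) (x ⊔ r)

record Ultrafilter (X : Setoid x r) : Set (suc (x ⊔ r)) where
  field
    family    : Family X
    inhabited : ∃[ A ] family A
    proper    : ∀ {A} → family A → Nonempty A
    upward    : ∀ {A B} → A ⊆ B → family A → family B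
    meet      : ∀ {A B} → family A → family B → family (A ∩ B)
    ultra     : ∀ A → family A ⊎ family (∁ A)

module _ {X : Setoid x r} (𝒰 : Ultrafilter X) where
  open Ultrafilter 𝒰

  Principal : Set (suc (x ⊔ r))
  Principal = ∃[ y ] (∀ A → family A ⇔ y ∈ A)

  Free : Set (suc (x ⊔ r))
  Free = ¬ Principal

record Partition (X : Setoid x r) : Set (suc (x ⊔ r)) where
  open Setoid X
  field
    Cell     : Family X
    resp     : Cell Respects _≐_
    nonempty : ∀ {P} → Cell P → Nonempty P
    disjoint : ∀ {P Q} → Cell P → Cell Q → Nonempty (P ∩ Q) → P ≐ Q
    cover    : ∀ y → ∃[ P ] (Cell P × y ∈ P)

record TransitiveGSpace (G : Group c ℓ) x r : Set (c ⊔ ℓ ⊔ suc (x ⊔ r)) where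
  open Group G using (Carrier; _≈_; _∙_; ε)
  field
    space : Setoid x r
  open Setoid space using () renaming (Carrier to X; _≈_ to _≋_)
  infixr 8 _·_
  field
    _·_        : Carrier → X → X
    ·-cong     : ∀ {g h y z} → g ≈ h → y ≋ z → g · y ≋ h · z
    ·-identity : ∀ y → ε · y ≋ y
    ·-assoc    : ∀ g h y → (g ∙ h) · y ≋ g · (h · y)
    transitive : ∀ y z → ∃[ g ] (g · y ≋ z)

  translate : Carrier → Func space space
  translate g = record { to = g ·_ ; cong = ·-cong (Group.refl G) }

  Invariant : Partition space → Set (c ⊔ suc (x ⊔ r))
  Invariant 𝒫 = ∀ g {P} → Cell P → Cell (image (translate g) P)
    where open Partition 𝒫

  Selective : Ultrafilter space → Set (c ⊔ suc (x ⊔ r))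
  Selective 𝒰 = ∀ (𝒫 : Partition space) → Invariant 𝒫 → let open Partition 𝒫 in
    (∃[ P ] (Cell P × family P)) ⊎
    (∃[ A ] (family A × (∀ {P} → Cell P → AtMostOne (P ∩ A))))
    where open Ultrafilter 𝒰

record Subgroup (G : Group c ℓ) p : Set (c ⊔ ℓ ⊔ suc p) where
  open Group G
  field
    mem       : Pred Carrier p
    resp      : mem Respects _≈_
    ε-closed  : mem ε
    ∙-closed  : ∀ {g h} → mem g → mem h → mem (g ∙ h)
    ⁻¹-closed : ∀ {g} → mem g → mem (g ⁻¹)

module _ {G : Group c ℓ} where
  open Group G
  open GroupProperties G
  open Subgroup

  infix 4 _≤_
  _≤_ : Subgroup G p → Subgroup G q → Set _
  S ≤ T = ∀ {g} → mem S g → mem T g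

  -- The element g stands for the coset gS; gS = hS iff g⁻¹h ∈ S.
  cosets : Subgroup G p → Setoid c p
  cosets S = record
    { Carrier       = Carrier
    ; _≈_           = λ g h → mem S (g ⁻¹ ∙ h)
    ; isEquivalence = record
      { refl  = λ {g} → resp S (sym (inverseˡ g)) (ε-closed S)
      ; sym   = λ {g} {h} g∼h → resp S (flip-quotient g h) (⁻¹-closed S g∼h)
      ; trans = λ {g} {h} {k} g∼h h∼k → resp S (compose g h k) (∙-closed S g∼h h∼k)
      }
    }
    where
    open SetoidReasoning setoid

    flip-quotient : ∀ g h → (g ⁻¹ ∙ h) ⁻¹ ≈ h ⁻¹ ∙ g
    flip-quotient g h = trans (⁻¹-anti-homo-∙ (g ⁻¹) h) (∙-congˡ (⁻¹-involutive g))

    compose : ∀ g h k → (g ⁻¹ ∙ h) ∙ (h ⁻¹ ∙ k) ≈ g ⁻¹ ∙ k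
    compose g h k = begin
      (g ⁻¹ ∙ h) ∙ (h ⁻¹ ∙ k) ≈⟨ assoc (g ⁻¹) h (h ⁻¹ ∙ k) ⟩
      g ⁻¹ ∙ (h ∙ (h ⁻¹ ∙ k)) ≈⟨ ∙-congˡ (assoc h (h ⁻¹) k) ⟨
      g ⁻¹ ∙ ((h ∙ h ⁻¹) ∙ k) ≈⟨ ∙-congˡ (∙-congʳ (inverseʳ h)) ⟩
      g ⁻¹ ∙ (ε ∙ k)          ≈⟨ ∙-congˡ (identityˡ k) ⟩
      g ⁻¹ ∙ k                ∎

  -- For S ≤ T: the left cosets tS with t ∈ T, so that |T:S| is its cardinality.
  cosetsIn : Subgroup G q → Subgroup G p → Setoid (c ⊔ q) p
  cosetsIn T S = On.setoid {B = Σ Carrier (mem T)} (cosets S) proj₁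

  cosetSpace : Subgroup G p → TransitiveGSpace G c p
  cosetSpace S = record
    { space      = cosets S
    ; _·_        = _∙_
    ; ·-cong     = λ {g} {h} {y} {z} g≈h → resp S (translate-cancel g h y z g≈h)
    ; ·-identity = λ y → ≈⇒∼ (identityˡ y)
    ; ·-assoc    = λ g h y → ≈⇒∼ (assoc g h y)
    ; transitive = λ y z → z ∙ y ⁻¹ , ≈⇒∼ (move y z)
    }
    where
    open SetoidReasoning setoid

    ≈⇒∼ : ∀ {g h} → g ≈ h → mem S (g ⁻¹ ∙ h)
    ≈⇒∼ {g} {h} g≈h = resp S (sym (trans (∙-congˡ (sym g≈h)) (inverseˡ g))) (ε-closed S)

    translate-cancel : ∀ g h y z → g ≈ h → y ⁻¹ ∙ z ≈ (g ∙ y) ⁻¹ ∙ (h ∙ z)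
    translate-cancel g h y z g≈h = sym (begin
      (g ∙ y) ⁻¹ ∙ (h ∙ z)       ≈⟨ ∙-cong (⁻¹-anti-homo-∙ g y) (∙-congʳ (sym g≈h)) ⟩
      (y ⁻¹ ∙ g ⁻¹) ∙ (g ∙ z)    ≈⟨ assoc (y ⁻¹) (g ⁻¹) (g ∙ z) ⟩
      y ⁻¹ ∙ (g ⁻¹ ∙ (g ∙ z))    ≈⟨ ∙-congˡ (assoc (g ⁻¹) g z) ⟨
      y ⁻¹ ∙ ((g ⁻¹ ∙ g) ∙ z)    ≈⟨ ∙-congˡ (∙-congʳ (inverseˡ g)) ⟩
      y ⁻¹ ∙ (ε ∙ z)             ≈⟨ ∙-congˡ (identityˡ z) ⟩
      y ⁻¹ ∙ z                   ∎)

    move : ∀ y z → (z ∙ y ⁻¹) ∙ y ≈ z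
    move y z = begin
      (z ∙ y ⁻¹) ∙ y ≈⟨ assoc z (y ⁻¹) y ⟩
      z ∙ (y ⁻¹ ∙ y) ≈⟨ ∙-congˡ (inverseˡ y) ⟩
      z ∙ ε          ≈⟨ identityʳ z ⟩
      z              ∎

{-# OPTIONS --safe #-}
module Submission where

-- If |T:S| and |G:T| are both infinite, the subsets of G/S that contain almost
-- all of almost every left coset of T form a proper filter.  An ultrafilter
-- extending it contains no coset of T and no set meeting each coset of T in at
-- most one point, since it contains the complements of both; so it is free and
-- the partition into cosets of T shows that it is not selective.
--
-- Conversely, the cells of an invariant partition are the left cosets of the
-- stabilizer T ⊇ S of the cell through S.  If |G:T| is finite, some cell lies
-- in the ultrafilter; if |T:S| is finite, G/S is a union of |T:S| transversals
-- of the cells, one of which lies in the ultrafilter.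

open import Defs
open import Level using (Level; _⊔_; suc; Lift; lift; lower)
open import Algebra.Bundles using (Group)
import Algebra.Properties.Group as GroupProperties
open import Axiom.ExcludedMiddle using (ExcludedMiddle)
open import Data.Empty using (⊥; ⊥-elim)
open import Data.Fin.Base using (Fin; zero) renaming (suc to fsuc)
open import Data.List.Base using (List; []; _∷_; [_]; _++_; length; lookup; deduplicate)
import Data.List.Membership.Setoid as Membership
open import Data.List.Membership.Setoid.Properties using (∈-++⁺ˡ; ∈-++⁺ʳ; ∈-lookup)
import Data.List.Relation.Unary.All as All
open import Data.List.Relation.Unary.AllPairs using (_∷_)
open import Data.List.Relation.Unary.Any using (here; there)
import Data.List.Relation.Unary.Enumerates.Setoid as Enumerates
import Data.List.Relation.Unary.Enumerates.Setoid.Properties as Enumerates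
open import Data.List.Relation.Unary.Unique.Setoid using (Unique)
open import Data.List.Relation.Unary.Unique.DecSetoid.Properties using (deduplicate-!)
open import Data.Nat.Base using (ℕ)
open import Data.Product.Base using (∃; ∃-syntax; Σ-syntax; _×_; _,_; proj₁; proj₂; swap)
open import Data.Sum.Base using (_⊎_; inj₁; inj₂; [_,_]′)
open import Data.Unit.Polymorphic.Base using (⊤; tt)
open import Function.Base using (id; _∘_)
open import Function.Bundles using (_⇔_; mk⇔; Func; Surjection; Inverse; Equivalence)
open import Function.Properties.Bijection using (Bijection⇒Inverse)
open import Relation.Binary.Bundles using (Setoid; DecSetoid)
import Relation.Binary.PropositionalEquality as ≡
open import Relation.Nullary.Decidable using (yes; no; True; toWitness; fromWitness; decidable-stable)
open import Relation.Nullary.Negation using (¬_; contradiction)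
open import Relation.Unary using (Pred) renaming (_⊆_ to _⊑_; _≐_ to _≋_)

private
  variable
    a b c ℓ ℓ₁ ℓ₂ p q u x r : Level

-- Finite lists up to setoid equality.

module _ (S : Setoid a ℓ) where
  open Setoid S

  lookup-injective : ∀ {xs} → Unique S xs → ∀ {i j} → lookup xs i ≈ lookup xs j → i ≡.≡ j
  lookup-injective (x# ∷ xs!) {zero}   {zero}   eq = ≡.refl
  lookup-injective (x# ∷ xs!) {zero}   {fsuc j} eq = contradiction eq (All.lookupₛ S respʳ x# (∈-lookup S _ j))
    where
    respʳ : ∀ {y z} → y ≈ z → ¬ (_ ≈ y) → ¬ (_ ≈ z)
    respʳ y≈z x≉y x≈z = x≉y (trans x≈z (sym y≈z))
  lookup-injective (x# ∷ xs!) {fsuc i} {zero}   eq =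
    ≡.sym (lookup-injective (x# ∷ xs!) (sym eq))
  lookup-injective (x# ∷ xs!) {fsuc i} {fsuc j} eq = ≡.cong fsuc (lookup-injective xs! eq)

module _ (A : Setoid a ℓ) where
  open Setoid A using (Carrier)
  open Membership A renaming (_∈_ to _∈ₗ_)

  -- The list may contain repetitions and elements outside `P`, so listability passes to subsets and
  -- unions without any counting.
  Listable : Pred Carrier q → Set (a ⊔ ℓ ⊔ q)
  Listable P = ∃[ xs ] ∀ {y} → P y → y ∈ₗ xs

  listable-⊑ : {P : Pred Carrier p} {Q : Pred Carrier q} → P ⊑ Q → Listable Q → Listable P
  listable-⊑ P⊑Q (xs , all) = xs , all ∘ P⊑Q

  listable-∪ : {P : Pred Carrier p} {Q : Pred Carrier q} →
               Listable P → Listable Q → Listable (λ y → P y ⊎ Q y)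
  listable-∪ (xs , allP) (ys , allQ) =
    xs ++ ys , [ ∈-++⁺ˡ A ∘ allP , ∈-++⁺ʳ A xs ∘ allQ ]′

-- Classical finiteness and transfinite iteration.

module Classical (em : ∀ ℓ → ExcludedMiddle ℓ) where

  dne : {P : Set ℓ} → ¬ ¬ P → P
  dne = decidable-stable (em _)

  -- Excluded middle lets every proposition live in an arbitrary universe.
  record Resize {ℓ} u (P : Set ℓ) : Set u where
    constructor truth
    field
      holds : True (em ℓ {P})

  resize : {P : Set ℓ} → P → Resize u P
  resize y = truth (fromWitness y)

  unresize : {P : Set ℓ} → Resize u P → P
  unresize y = toWitness (Resize.holds y)

  -- Excluded middle decides the setoid equality, so repetitions can be removed, after which
  -- `lookup` is a bijection.
  enumeration⇒finite : (A : Setoid a ℓ) → ∃ (Enumerates.IsEnumeration A) → Finite A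
  enumeration⇒finite A (xs , enum) = length ys , Bijection⇒Inverse (record
    { to        = lookup ys
    ; cong      = λ { ≡.refl → Setoid.refl A }
    ; bijective = lookup-injective A (deduplicate-! A? xs)
                , Enumerates.lookup-surjective A (Enumerates.deduplicate⁺ A? enum)
    })
    where
    A? : DecSetoid _ _
    A? = record
      { isDecEquivalence = record
        { isEquivalence = Setoid.isEquivalence A
        ; _≟_           = λ _ _ → em _
        }
      }

    ys : List (Setoid.Carrier A)
    ys = deduplicate (DecSetoid._≟_ A?) xs

  -- One preimage is kept for each listed point that has any; `inj` makes it the only one up to
  -- equality.
  listable-preimage : (A : Setoid a ℓ₁) (B : Setoid b ℓ₂) {P : Pred (Setoid.Carrier B) p}
    (f : Setoid.Carrier A → Setoid.Carrier B) →
    (∀ {y z} → Setoid._≈_ B (f y) (f z) → Setoid._≈_ A y z) → (∀ y → P (f y)) →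
    Listable B P → Finite A
  listable-preimage A B f inj Pf (zs , all) =
    enumeration⇒finite A (preimage zs , λ y → ∈-preimage zs (all (Pf y)))
    where
    open Setoid B using (_≈_; sym; trans)
    open Membership A renaming (_∈_ to _∈₁_)
    open Membership B renaming (_∈_ to _∈₂_)

    preimage : List (Setoid.Carrier B) → List (Setoid.Carrier A)
    preimage []       = []
    preimage (z ∷ zs) with em _ {∃[ y ] f y ≈ z}
    ... | yes (y , _) = y ∷ preimage zs
    ... | no _        = preimage zs

    ∈-preimage : ∀ zs {y} → f y ∈₂ zs → y ∈₁ preimage zs
    ∈-preimage (z ∷ zs) fy∈ with em _ {∃[ y ] f y ≈ z}
    ∈-preimage (z ∷ zs) (here fy≈z)  | yes (w , fw≈z) = here (inj (trans fy≈z (sym fw≈z)))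
    ∈-preimage (z ∷ zs) (there fy∈)  | yes _          = there (∈-preimage zs fy∈)
    ∈-preimage (z ∷ zs) (here fy≈z)  | no ∄           = contradiction (_ , fy≈z) ∄
    ∈-preimage (z ∷ zs) (there fy∈)  | no _           = ∈-preimage zs fy∈

  -- Bourbaki–Witt: every member of the tower is extreme, so the tower is a
  -- chain, and its union absorbs f.
  module Iteration {B : Set b} (base : Pred B u) (f : Pred B u → Pred B u)
    (f-inflationary : ∀ {F} → F ⊑ f F) (f-cong : ∀ {F H} → F ≋ H → f F ⊑ f H) where

    -- Building in `base` makes the empty union equal to `base`, the bottom of the tower.
    ⋃ : Pred (Pred B u) u → Pred B u
    ⋃ 𝒞 y = Resize u (base y ⊎ (∃[ F ] (𝒞 F × F y)))

    data Tower : Pred (Pred B u) (b ⊔ suc u) where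
      next  : ∀ {F} → Tower F → Tower (f F)
      union : (𝒞 : Pred (Pred B u) u) → (∀ {F} → 𝒞 F → Tower F) → Tower (⋃ 𝒞)

    Chain : Pred (Pred B u) u → Set (b ⊔ suc u)
    Chain 𝒞 = ∀ {F H} → 𝒞 F → 𝒞 H → F ⊑ H ⊎ H ⊑ F

    ⊑-⋃ : ∀ {𝒞 F} → 𝒞 F → F ⊑ ⋃ 𝒞
    ⊑-⋃ 𝒞F Fy = resize (inj₂ (_ , 𝒞F , Fy))

    base⊑⋃ : ∀ {𝒞} → base ⊑ ⋃ 𝒞
    base⊑⋃ y∈ = resize (inj₁ y∈)

    ⋃-⊑ : ∀ {𝒞} {H : Pred B u} → base ⊑ H → (∀ {F} → 𝒞 F → F ⊑ H) → ⋃ 𝒞 ⊑ H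
    ⋃-⊑ base⊑H 𝒞⊑H y∈ with unresize y∈
    ... | inj₁ y∈base        = base⊑H y∈base
    ... | inj₂ (_ , 𝒞F , Fy) = 𝒞⊑H 𝒞F Fy

    base⊑ : ∀ {F} → Tower F → base ⊑ F
    base⊑ (next tF)   = f-inflationary ∘ base⊑ tF
    base⊑ (union _ _) = base⊑⋃

    Extreme : Pred (Pred B u) (b ⊔ suc u)
    Extreme F = ∀ {H} → Tower H → H ⊑ F → ¬ (F ⊑ H) → f H ⊑ F

    -- Induction on `Tower H`. At `f H` with `H ⊑ F`, either `H` equals `F` and `f-cong` applies, or
    -- `H` is strictly smaller and extremeness gives `f H ⊑ F`. A union lies below `F` unless some
    -- member lies above `f F`.
    extreme-comparable : ∀ {F} → Tower F → Extreme F → ∀ {H} → Tower H → H ⊑ F ⊎ f F ⊑ H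
    extreme-comparable {F} tF eF (next {H} tH) with extreme-comparable tF eF tH
    ... | inj₂ fF⊑H = inj₂ (f-inflationary ∘ fF⊑H)
    ... | inj₁ H⊑F with em _ {F ⊑ H}
    ...   | yes F⊑H = inj₂ (f-cong (F⊑H , H⊑F))
    ...   | no  F⋢H = inj₁ (eF tH H⊑F F⋢H)
    extreme-comparable {F} tF eF (union 𝒞 t𝒞) with em _ {∃[ H ] (𝒞 H × f F ⊑ H)}
    ... | yes (H , 𝒞H , fF⊑H) = inj₂ (⊑-⋃ 𝒞H ∘ fF⊑H)
    ... | no  ∄               = inj₁ (⋃-⊑ (base⊑ tF) below)
      where
      below : ∀ {H} → 𝒞 H → H ⊑ F
      below 𝒞H with extreme-comparable tF eF (t𝒞 𝒞H)
      ... | inj₁ H⊑F  = H⊑F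
      ... | inj₂ fF⊑H = ⊥-elim (∄ (_ , 𝒞H , fF⊑H))

    -- Induction on the tower. A member strictly below `f F` lies below `F` by comparability: if
    -- equal to `F`, `f-cong` applies, otherwise extremeness of `F` does. If `H` is strictly below a
    -- union, some `F` in that union is not below `H`, and extremeness of this `F` bounds `f H`.
    extreme : ∀ {F} → Tower F → Extreme F
    extreme (next {F} tF) tH H⊑fF fF⋢H with extreme-comparable tF (extreme tF) tH
    ... | inj₂ fF⊑H = ⊥-elim (fF⋢H fF⊑H)
    ... | inj₁ H⊑F with em _ {F ⊑ _}
    ...   | yes F⊑H = f-cong (H⊑F , F⊑H)
    ...   | no  F⋢H = f-inflationary ∘ extreme tF tH H⊑F F⋢H
    extreme (union 𝒞 t𝒞) {H} tH H⊑ ⋢H with em _ {∃[ F ] (𝒞 F × ¬ (F ⊑ H))}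
    ... | no ∄ = ⊥-elim (⋢H (⋃-⊑ (base⊑ tH) below))
      where
      below : ∀ {F} → 𝒞 F → F ⊑ H
      below {F} 𝒞F = dne {P = F ⊑ H} (λ F⋢H → ∄ (F , 𝒞F , F⋢H))
    ... | yes (F , 𝒞F , F⋢H) with extreme-comparable (t𝒞 𝒞F) (extreme (t𝒞 𝒞F)) tH
    ...   | inj₁ H⊑F  = ⊑-⋃ 𝒞F ∘ extreme (t𝒞 𝒞F) tH H⊑F F⋢H
    ...   | inj₂ fF⊑H = ⊥-elim (F⋢H (fF⊑H ∘ f-inflationary))

    comparable : ∀ {F H} → Tower F → Tower H → F ⊑ H ⊎ H ⊑ F
    comparable tF tH with extreme-comparable tF (extreme tF) tH
    ... | inj₁ H⊑F  = inj₂ H⊑F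
    ... | inj₂ fF⊑H = inj₁ (fF⊑H ∘ f-inflationary)

    limit : Pred B u
    -- `Tower` lives in a larger universe; resizing it lets the union of the whole tower be a member
    -- of the tower.
    limit = ⋃ (λ F → Resize u (Tower F))

    limit-tower : Tower limit
    limit-tower = union _ unresize

    limit-closed : f limit ⊑ limit
    limit-closed = ⊑-⋃ (resize (next limit-tower))

    -- Comparability supplies the chain hypothesis, needed for a union of filters to be closed under
    -- intersection.
    tower-induction : (Q : Pred (Pred B u) q) → (∀ {F} → Q F → Q (f F)) →
      (∀ {𝒞} → Chain 𝒞 → (∀ {F} → 𝒞 F → Q F) → Q (⋃ 𝒞)) → ∀ {F} → Tower F → Q F
    tower-induction Q Q-next Q-union (next tF)     = Q-next (tower-induction Q Q-next Q-union tF)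
    tower-induction Q Q-next Q-union (union 𝒞 t𝒞) = Q-union
      (λ 𝒞F 𝒞H → comparable (t𝒞 𝒞F) (t𝒞 𝒞H))
      (λ 𝒞F → tower-induction Q Q-next Q-union (t𝒞 𝒞F))

-- Extension of filters to ultrafilters.

record IsFilter {X : Setoid x r} (F : Family X) : Set (suc (x ⊔ r)) where
  field
    inhabited : ∃[ A ] F A
    proper    : ∀ {A} → F A → Nonempty A
    upward    : ∀ {A B} → A ⊆ B → F A → F B
    meet      : ∀ {A B} → F A → F B → F (A ∩ B)

module _ {X : Setoid x r} (em : ∀ ℓ → ExcludedMiddle ℓ)
  (choice : ∀ a ℓ₁ b ℓ₂ → Choice a ℓ₁ b ℓ₂) where
  open Classical em

  Undecided : Family X → Pred (Subset X) (x ⊔ r)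
  Undecided F A = ¬ F A × ¬ F (∁ A)

  -- `families` and `pointed-families` have the same elements, but equality here ignores the
  -- undecided set. A section of `forget` thus picks an undecided set depending only on the family,
  -- up to `≋` and `≐`, as `extend-cong` requires.
  families : Setoid (suc (x ⊔ r)) (suc (x ⊔ r))
  families = record
    { Carrier       = ∃[ F ] ∃ (Undecided F)
    ; _≈_           = λ (F , _) (H , _) → F ≋ H
    ; isEquivalence = record
      { refl  = id , id
      ; sym   = swap
      ; trans = λ (F⊑H , H⊑F) (H⊑K , K⊑H) → H⊑K ∘ F⊑H , H⊑F ∘ K⊑H
      }
    }

  pointed-families : Setoid (suc (x ⊔ r)) (suc (x ⊔ r))
  pointed-families = record
    { Carrier       = ∃[ F ] ∃ (Undecided F)
    ; _≈_           = λ (F , A , _) (H , B , _) → F ≋ H × A ≐ B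
    ; isEquivalence = record
      { refl  = (id , id) , (id , id)
      ; sym   = λ (F≋H , A≐B) → swap F≋H , swap A≐B
      ; trans = λ ((F⊑H , H⊑F) , (A⊆B , B⊆A)) ((H⊑K , K⊑H) , (B⊆C , C⊆B)) →
          (H⊑K ∘ F⊑H , H⊑F ∘ K⊑H) ,
          ((λ y∈ → B⊆C (A⊆B y∈)) , (λ y∈ → B⊆A (C⊆B y∈)))
      }
    }

  forget : Surjection pointed-families families
  forget = record
    { to         = id
    ; cong       = proj₁
    ; surjective = λ F → F , proj₁
    }

  section = choice _ _ _ _ pointed-families families forget

  chosen : ∀ {F} → ∃ (Undecided F) → Subset X
  chosen e = proj₁ (proj₂ (Func.to (proj₁ section) (_ , e)))

  chosen-undecided : ∀ {F} (e : ∃ (Undecided F)) → Undecided F (chosen e)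
  -- The section returns a family equal to `F` only up to `≋`, so undecidedness is carried back
  -- along the inclusion of `F` in it.
  chosen-undecided e with Func.to (proj₁ section) (_ , e) | proj₂ section (_ , e)
  ... | _ , _ , (¬A , ¬∁A) | _ , F⊑H = ¬A ∘ F⊑H , ¬∁A ∘ F⊑H

  chosen-cong : ∀ {F H} → F ≋ H → (e : ∃ (Undecided F)) (e′ : ∃ (Undecided H)) → chosen e ≐ chosen e′
  chosen-cong F≋H e e′ = proj₂ (Func.cong (proj₁ section) {_ , e} {_ , e′} F≋H)

  -- The intersection over all e is the chosen undecided set of F if there is
  -- one, and the whole space otherwise.
  Adjoined : Family X → Pred (Setoid.Carrier X) (suc (x ⊔ r))
  Adjoined F y = ∀ (e : ∃ (Undecided F)) → y ∈ chosen e

  -- For a filter `F`, this is the filter generated by `F` and its chosen undecided set, if there is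
  -- one.
  extend : Family X → Family X
  extend F C = Resize (x ⊔ r) (∃[ D ] (F D × (∀ {y} → y ∈ D → Adjoined F y → y ∈ C)))

  extend-inflationary : ∀ {F} → F ⊑ extend F
  extend-inflationary {x = C} FC = resize (C , FC , λ y∈C _ → y∈C)

  extend-cong : ∀ {F H} → F ≋ H → extend F ⊑ extend H
  extend-cong (F⊑H , H⊑F) FC with unresize FC
  ... | D , FD , D∩⊆C = resize (D , F⊑H FD , λ y∈D adj → D∩⊆C y∈D
    (λ e@(A , ¬A , ¬∁A) → let e′ = A , ¬A ∘ H⊑F , ¬∁A ∘ H⊑F in
      proj₁ (chosen-cong (H⊑F , F⊑H) e′ e) (adj e′)))

  extend-filter : ∀ {F} → IsFilter F → IsFilter (extend F)
  extend-filter {F} filter = record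
    { inhabited = let A , FA = inhabited in A , extend-inflationary {F = F} {A} FA
    ; proper    = λ {A} → proper′ {A}
    ; upward    = λ A⊆B A∈ → let D , FD , D∩⊆A = unresize A∈ in
        resize (D , FD , λ y∈D adj → A⊆B (D∩⊆A y∈D adj))
    ; meet      = λ A∈ B∈ → let
          D , FD , D∩⊆A = unresize A∈
          E , FE , E∩⊆B = unresize B∈
        in resize (D ∩ E , meet FD FE , λ (y∈D , y∈E) adj → D∩⊆A y∈D adj , E∩⊆B y∈E adj)
    }
    where
    open IsFilter filter

    proper′ : ∀ {C} → extend F C → Nonempty C
    proper′ C∈ with unresize C∈
    ... | D , FD , D∩⊆C with em _ {∃ (Undecided F)}
    ...   | no ∄ = let y , y∈D = proper FD in y , D∩⊆C y∈D (λ e → contradiction e ∄)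
    -- If `C` were empty, `D` would lie in the complement of the chosen set, which would then belong
    -- to `F`.
    ...   | yes e = dne λ C-empty → proj₂ (chosen-undecided e) (upward
      (λ y∈D y∈A → C-empty (_ , D∩⊆C y∈D
        (λ e′ → proj₁ (chosen-cong (id , id) e e′) y∈A))) FD)

  module _ (base : Family X) (base-filter : IsFilter base) where
    open Iteration base extend extend-inflationary extend-cong

    -- Two sets in the union lie in a common family because `𝒞` is a chain; `base ⊑ F` handles the
    -- sets that come from `base`.
    ⋃-filter : ∀ {𝒞} → Chain 𝒞 → (∀ {F} → 𝒞 F → IsFilter F × base ⊑ F) → IsFilter (⋃ 𝒞)
    ⋃-filter {𝒞} chain filters = record
      { inhabited = let A , A∈ = IsFilter.inhabited base-filter in A , base⊑⋃ A∈
      ; proper    = proper′ ∘ unresize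
      ; upward    = λ A⊆B A∈ → resize (upward′ A⊆B (unresize A∈))
      ; meet      = λ A∈ B∈ → meet′ (unresize A∈) (unresize B∈)
      }
      where
      proper′ : ∀ {A} → base A ⊎ (∃[ F ] (𝒞 F × F A)) → Nonempty A
      proper′ (inj₁ A∈)            = IsFilter.proper base-filter A∈
      proper′ (inj₂ (F , 𝒞F , A∈)) = IsFilter.proper (proj₁ (filters 𝒞F)) A∈

      upward′ : ∀ {A B} → A ⊆ B → base A ⊎ (∃[ F ] (𝒞 F × F A)) → base B ⊎ (∃[ F ] (𝒞 F × F B))
      upward′ A⊆B (inj₁ A∈)            = inj₁ (IsFilter.upward base-filter A⊆B A∈)
      upward′ A⊆B (inj₂ (F , 𝒞F , A∈)) = inj₂ (F , 𝒞F , IsFilter.upward (proj₁ (filters 𝒞F)) A⊆B A∈)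

      meet-in : ∀ {F A B} → 𝒞 F → F A → F B → ⋃ 𝒞 (A ∩ B)
      meet-in 𝒞F A∈ B∈ = ⊑-⋃ 𝒞F (IsFilter.meet (proj₁ (filters 𝒞F)) A∈ B∈)

      meet′ : ∀ {A B} → base A ⊎ (∃[ F ] (𝒞 F × F A)) → base B ⊎ (∃[ F ] (𝒞 F × F B)) →
              ⋃ 𝒞 (A ∩ B)
      meet′ (inj₁ A∈) (inj₁ B∈) = base⊑⋃ (IsFilter.meet base-filter A∈ B∈)
      meet′ (inj₁ A∈) (inj₂ (_ , 𝒞F , B∈)) = meet-in 𝒞F (proj₂ (filters 𝒞F) A∈) B∈
      meet′ (inj₂ (_ , 𝒞F , A∈)) (inj₁ B∈) = meet-in 𝒞F A∈ (proj₂ (filters 𝒞F) B∈)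
      meet′ (inj₂ (_ , 𝒞F , A∈)) (inj₂ (_ , 𝒞H , B∈)) with chain 𝒞F 𝒞H
      ... | inj₁ F⊑H = meet-in 𝒞H (F⊑H A∈) B∈
      ... | inj₂ H⊑F = meet-in 𝒞F A∈ (H⊑F B∈)

    limit-filter : IsFilter limit
    limit-filter = proj₁ (tower-induction (λ F → IsFilter F × base ⊑ F)
      (λ (filter , base⊑F) → extend-filter filter , extend-inflationary ∘ base⊑F)
      (λ chain filters → ⋃-filter chain filters , base⊑⋃)
      limit-tower)

    -- If `A` were undecided, the chosen set of `limit`, possibly different from `A`, would lie in
    -- `extend limit`, hence in `limit` by `limit-closed`, contradicting its own undecidedness.
    limit-ultra : ∀ A → limit A ⊎ limit (∁ A)
    limit-ultra A with em _ {limit A} | em _ {limit (∁ A)}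
    ... | yes A∈ | _       = inj₁ A∈
    ... | no  _  | yes ∁A∈ = inj₂ ∁A∈
    ... | no  A∉ | no ∁A∉  = contradiction
      (limit-closed (resize (D , D∈ , λ _ adj → adj e)))
      (proj₁ (chosen-undecided e))
      where
      e : ∃ (Undecided limit)
      e = A , A∉ , ∁A∉

      D = proj₁ (IsFilter.inhabited limit-filter)
      D∈ = proj₂ (IsFilter.inhabited limit-filter)

    ultrafilter-extension : Σ[ 𝒰 ∈ Ultrafilter X ] (base ⊑ Ultrafilter.family 𝒰)
    ultrafilter-extension = record
      { family    = limit
      ; inhabited = inhabited
      ; proper    = proper
      ; upward    = upward
      ; meet      = meet
      ; ultra     = limit-ultra
      } , base⊑⋃
      where open IsFilter limit-filter

-- Ultrafilters and finite covers.

module _ {X : Setoid x r} (𝒰 : Ultrafilter X) where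
  open Ultrafilter 𝒰

  -- If `A zero` is not in the ultrafilter, the remaining sets cover `B` minus `A zero`, which is;
  -- hence the induction is over all `B`. With no sets left, `B` would be empty.
  finite-cover : ∀ n (A : Fin n → Subset X) {B : Subset X} → family B →
    (∀ {y} → y ∈ B → ∃[ i ] y ∈ A i) → ∃[ i ] family (A i)
  finite-cover ℕ.zero A B∈ cover with _ , y∈B ← proper B∈ with () ← proj₁ (cover y∈B)
  finite-cover (ℕ.suc n) A {B} B∈ cover with ultra (A zero)
  ... | inj₁ A₀∈  = zero , A₀∈
  ... | inj₂ ∁A₀∈ =
    let i , Aᵢ∈ = finite-cover n (A ∘ fsuc) (meet B∈ ∁A₀∈) cover′ in fsuc i , Aᵢ∈
    where
    cover′ : ∀ {y} → y ∈ B ∩ ∁ (A zero) → ∃[ i ] y ∈ A (fsuc i)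
    cover′ (y∈B , y∉A₀) with cover y∈B
    ... | zero   , y∈A₀ = contradiction y∈A₀ y∉A₀
    ... | fsuc i , y∈Aᵢ = i , y∈Aᵢ

-- Left translation and cancellation modulo a subgroup.

module _ {G : Group c ℓ} (S : Subgroup G p) where
  open Group G
  open GroupProperties G
  open Setoid (cosets S) using () renaming (_≈_ to _∼_; trans to ∼-trans)
  open TransitiveGSpace (cosetSpace S) using (·-cong)

  ≈⇒∼ : ∀ {g h} → g ≈ h → g ∼ h
  ≈⇒∼ g≈h = Subgroup.resp S (sym (trans (∙-congˡ (sym g≈h)) (inverseˡ _))) (Subgroup.ε-closed S)

  ∼-∙ˡ : ∀ g {h k} → h ∼ k → g ∙ h ∼ g ∙ k
  ∼-∙ˡ g = ·-cong {g} {g} refl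

  ∼-∙ˡ⁻ : ∀ g {h k} → g ∙ h ∼ g ∙ k → h ∼ k
  ∼-∙ˡ⁻ g gh∼gk = ∼-trans (≈⇒∼ (sym (\\-leftDividesʳ g _)))
    (∼-trans (∼-∙ˡ (g ⁻¹) gh∼gk) (≈⇒∼ (\\-leftDividesʳ g _)))

module _ (em : ∀ ℓ → ExcludedMiddle ℓ) (choice : ∀ a ℓ₁ b ℓ₂ → Choice a ℓ₁ b ℓ₂)
  {G : Group c ℓ} (S : Subgroup G p) where
  open Classical em
  open Group G
  open GroupProperties G
  open TransitiveGSpace (cosetSpace S) using (space; Invariant; Selective; ·-cong)
  open Setoid (cosets S) using ()
    renaming (_≈_ to _∼_; refl to ∼-refl; sym to ∼-sym; trans to ∼-trans)

  -- A non-selective free ultrafilter from two infinite indices.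

  module InfiniteIndices (T : Subgroup G p) (S≤T : S ≤ T)
    (T/S-infinite : Infinite (cosetsIn T S)) (G/T-infinite : Infinite (cosets T)) where
    open Setoid (cosets T) using ()
      renaming (_≈_ to _∼ᵀ_; refl to ∼ᵀ-refl; sym to ∼ᵀ-sym; trans to ∼ᵀ-trans)

    coset : Carrier → Subset space
    coset g = record
      { mem  = λ y → Lift (c ⊔ p) (g ∼ᵀ y)
      ; resp = λ y∼z (lift g∼y) → lift (∼ᵀ-trans g∼y (S≤T y∼z))
      }

    left-cosets : Partition space
    left-cosets = record
      { Cell     = λ P → ∃[ g ] P ≐ coset g
      ; resp     = λ (P⊆Q , Q⊆P) (g , P⊆g , g⊆P) → g , (λ y∈ → P⊆g (Q⊆P y∈)) , (λ y∈ → P⊆Q (g⊆P y∈))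
      ; nonempty = λ (g , _ , g⊆P) → g , g⊆P (lift ∼ᵀ-refl)
      ; disjoint = λ {P} {Q} P-cell Q-cell (y , y∈P , y∈Q) →
          meeting {P} {Q} P-cell Q-cell y∈P y∈Q , meeting {Q} {P} Q-cell P-cell y∈Q y∈P
      ; cover    = λ y → coset y , (y , id , id) , lift ∼ᵀ-refl
      }
      where
      meeting : ∀ {P Q y} → ∃[ g ] P ≐ coset g → ∃[ h ] Q ≐ coset h → y ∈ P → y ∈ Q → P ⊆ Q
      meeting (g , P⊆g , _) (h , Q⊆h , h⊆Q) y∈P y∈Q z∈P = h⊆Q (lift
        (∼ᵀ-trans (lower (Q⊆h y∈Q)) (∼ᵀ-trans (∼ᵀ-sym (lower (P⊆g y∈P))) (lower (P⊆g z∈P)))))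

    left-cosets-invariant : Invariant left-cosets
    left-cosets-invariant h (g , P⊆g , g⊆P) = h ∙ g ,
      (λ (y , y∈P , z∼hy) →
        lift (∼ᵀ-trans (∼-∙ˡ T h (lower (P⊆g y∈P))) (∼ᵀ-sym (S≤T z∼hy)))) ,
      (λ {z} (lift hg∼z) → h ⁻¹ ∙ z ,
        g⊆P (lift (∼-∙ˡ⁻ T h (∼ᵀ-trans hg∼z (≈⇒∼ T (sym (\\-leftDividesˡ h z)))))) ,
        ≈⇒∼ S (sym (\\-leftDividesˡ h z)))

    -- The sets containing all but finitely many points of all but finitely many
    -- left cosets of T, counting points and cosets up to equality in G/S and G/T.
    fréchet : Family space
    fréchet A = Listable (cosets T)
      (λ g → ¬ Listable (cosets S) (λ y → g ∼ᵀ y × ¬ (y ∈ A)))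

    fréchet-filter : IsFilter fréchet
    fréchet-filter = record
      { inhabited = whole , [] , λ ¬empty → ⊥-elim (¬empty ([] , λ (_ , y∉) → ⊥-elim (y∉ tt)))
      ; proper    = λ {A} → proper {A}
      ; upward    = λ A⊆B → listable-⊑ (cosets T)
          (λ ¬B A-listable → ¬B (listable-⊑ (cosets S) (λ (g∼y , y∉B) → g∼y , λ y∈A → y∉B (A⊆B y∈A)) A-listable))
      ; meet      = λ {A} {B} A∈ B∈ → listable-⊑ (cosets T) (meet {A} {B}) (listable-∪ (cosets T) A∈ B∈)
      }
      where
      whole : Subset space
      whole = record { mem = λ _ → ⊤ ; resp = λ _ _ → tt }

      -- Let `A` be empty. A coset `gT` with finitely many points outside `A` would make `|T:S|`
      -- finite, through the injection of `T/S` into `gT` sending `t` to `gt`. So every coset is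
      -- exceptional, and the list of exceptions makes `|G:T|` finite.
      proper : ∀ {A} → fréchet A → Nonempty A
      proper {A} (gs , all) = dne λ A-empty → G/T-infinite
        (enumeration⇒finite (cosets T) (gs , λ g → all λ gT∖A-listable → T/S-infinite
          (listable-preimage (cosetsIn T S) (cosets S) (λ (t , _) → g ∙ t) (∼-∙ˡ⁻ S g)
            (λ (t , t∈T) → Subgroup.resp T (sym (\\-leftDividesʳ g t)) t∈T , λ gt∈A → A-empty (_ , gt∈A))
            gT∖A-listable)))

      Outside : Subset space → Carrier → Pred Carrier (c ⊔ p)
      Outside A g y = g ∼ᵀ y × ¬ (y ∈ A)

      meet : ∀ {A B g} → ¬ Listable (cosets S) (Outside (A ∩ B) g) →
             ¬ Listable (cosets S) (Outside A g) ⊎ ¬ Listable (cosets S) (Outside B g)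
      meet {A} {B} {g} ¬A∩B with em _ {Listable (cosets S) (Outside A g)}
      ... | no ¬A = inj₁ ¬A
      ... | yes A-listable = inj₂ λ B-listable →
        ¬A∩B (listable-⊑ (cosets S) split (listable-∪ (cosets S) A-listable B-listable))
        where
        split : Outside (A ∩ B) g ⊑ (λ y → Outside A g y ⊎ Outside B g y)
        split {y} (g∼y , y∉A∩B) with em _ {y ∈ A}
        ... | yes y∈A = inj₂ (g∼y , λ y∈B → y∉A∩B (y∈A , y∈B))
        ... | no  y∉A = inj₁ (g∼y , y∉A)

    -- Each coset has at most one point outside `∁ A`, so the list of exceptional cosets is empty.
    thin-∁∈fréchet : ∀ {A} → (∀ g → AtMostOne (coset g ∩ A)) → fréchet (∁ A)
    thin-∁∈fréchet {A} thin = [] , λ {g} ¬finite → ⊥-elim (¬finite (listable g))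
      where
      listable : ∀ g → Listable (cosets S) (λ y → g ∼ᵀ y × ¬ (y ∈ ∁ A))
      listable g with em _ {Nonempty (coset g ∩ A)}
      ... | yes (y , y∈) = [ y ] , λ (g∼z , z∈A) → here (thin g (lift g∼z , dne z∈A) y∈)
      ... | no  empty    = [] , λ (g∼z , z∈A) → ⊥-elim (z∈A λ z∈A → empty (_ , lift g∼z , z∈A))

    -- Every coset of `T` other than `gT` is disjoint from `P`, so `g` alone needs listing.
    coset-∁∈fréchet : ∀ {P} → ∃[ g ] P ≐ coset g → fréchet (∁ P)
    coset-∁∈fréchet (g , P⊆g , _) = [ g ] , λ ¬finite → here (dne λ h≁g →
      ¬finite ([] , λ (h∼y , y∈P) → ⊥-elim (y∈P λ y∈P →
        h≁g (∼ᵀ-trans h∼y (∼ᵀ-sym (lower (P⊆g y∈P)))))))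

    nonselective : ¬ (∀ (𝒰 : Ultrafilter space) → Free 𝒰 → Selective 𝒰)
    nonselective selective with ultrafilter-extension em choice fréchet fréchet-filter
    ... | 𝒰 , fréchet⊑𝒰 = absurd (selective 𝒰 free left-cosets left-cosets-invariant)
      where
      open Ultrafilter 𝒰

      ∁-proper : ∀ A → family A → ¬ fréchet (∁ A)
      ∁-proper A A∈ ∁A∈ with _ , y∈A , y∉A ← proper (meet A∈ (fréchet⊑𝒰 {x = ∁ A} ∁A∈)) = y∉A y∈A

      singleton : Carrier → Subset space
      singleton y = record
        { mem  = λ z → Lift (c ⊔ p) (y ∼ z)
        ; resp = λ z∼w (lift y∼z) → lift (∼-trans y∼z z∼w)
        }

      free : Free 𝒰
      -- A singleton meets each coset in at most one point, so its complement already lies in `𝒰`.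
      free (y , principal) = ∁-proper (singleton y)
        (Equivalence.from (principal (singleton y)) (lift ∼-refl))
        (thin-∁∈fréchet {singleton y} λ _ (_ , lift y∼z) (_ , lift y∼w) → ∼-trans (∼-sym y∼z) y∼w)

      absurd : (∃[ P ] (∃[ g ] P ≐ coset g) × family P) ⊎
        (∃[ A ] (family A × (∀ {P} → ∃[ g ] P ≐ coset g → AtMostOne (P ∩ A)))) → ⊥
      absurd (inj₁ (P , P-cell , P∈)) = ∁-proper P P∈ (coset-∁∈fréchet {P} P-cell)
      absurd (inj₂ (A , A∈ , thin))   = ∁-proper A A∈ (thin-∁∈fréchet {A} λ g → thin {coset g} (g , id , id))

  -- Invariant partitions and their stabilizers.

  module FiniteIndices (𝒫 : Partition space) (invariant : Invariant 𝒫) where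
    open Partition 𝒫 renaming (resp to Cell-resp)

    P₀ : Subset space
    P₀ = proj₁ (cover ε)

    P₀-cell : Cell P₀
    P₀-cell = proj₁ (proj₂ (cover ε))

    ε∈P₀ : ε ∈ P₀
    ε∈P₀ = proj₂ (proj₂ (cover ε))

    -- The translate of `P` by `g ⁻¹` is a cell containing `ε`, hence equals `P₀`.
    cell-quotient : ∀ {P g h} → Cell P → g ∈ P → h ∈ P → g ⁻¹ ∙ h ∈ P₀
    cell-quotient {P} {g} {h} P-cell g∈P h∈P = proj₁
      (disjoint (invariant (g ⁻¹) P-cell) P₀-cell
        (ε , (g , g∈P , ≈⇒∼ S (sym (inverseˡ g))) , ε∈P₀))
      (h , h∈P , ∼-refl)

    -- The translate of `P₀` by `g` is a cell containing `g`, hence equals `P`.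
    quotient-cell : ∀ {P g h} → Cell P → g ∈ P → g ⁻¹ ∙ h ∈ P₀ → h ∈ P
    quotient-cell {P} {g} {h} P-cell g∈P g⁻¹h∈P₀ = proj₁
      (disjoint (invariant g P₀-cell) P-cell
        (g , (ε , ε∈P₀ , ≈⇒∼ S (sym (identityʳ g))) , g∈P))
      (g ⁻¹ ∙ h , g⁻¹h∈P₀ , ≈⇒∼ S (sym (\\-leftDividesˡ g h)))

    P₀-resp : ∀ {g h} → g ≈ h → g ∈ P₀ → h ∈ P₀
    P₀-resp g≈h = Subset.resp P₀ (≈⇒∼ S g≈h)

    -- An element `g` fixes the cell `P₀` exactly when `g` itself lies in `P₀`. Membership is
    -- resized because the hypothesis on indices concerns subgroups at level `p`.
    stabilizer : Subgroup G p
    stabilizer = record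
      { mem       = λ g → Resize p (g ∈ P₀)
      ; resp      = λ g≈h g∈ → resize (P₀-resp g≈h (unresize g∈))
      ; ε-closed  = resize ε∈P₀
      ; ∙-closed  = λ {g} {h} g∈ h∈ → resize (quotient-cell P₀-cell (unresize g∈)
          (P₀-resp (sym (\\-leftDividesʳ g h)) (unresize h∈)))
      ; ⁻¹-closed = λ g∈ → resize
          (P₀-resp (identityʳ _) (cell-quotient P₀-cell (unresize g∈) ε∈P₀))
      }

    S≤stabilizer : S ≤ stabilizer
    S≤stabilizer {g} g∈S =
      resize (Subset.resp P₀ (Subgroup.resp S (sym (trans (∙-congʳ ε⁻¹≈ε) (identityˡ g))) g∈S) ε∈P₀)

    module _ (𝒰 : Ultrafilter space) where
      open Ultrafilter 𝒰

      cell-in : Finite (cosets stabilizer) → ∃[ P ] (Cell P × family P)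
      cell-in (n , indexing) =
        let i , Pᵢ∈ = finite-cover 𝒰 n P (proj₂ inhabited) covering
        in P i , proj₁ (proj₂ (cover (to i))) , Pᵢ∈
        where
        open Inverse indexing using (to; from; strictlyInverseˡ)

        P : Fin n → Subset space
        P i = proj₁ (cover (to i))

        covering : ∀ {y} → y ∈ proj₁ inhabited → ∃[ i ] y ∈ P i
        covering {y} _ = from y , quotient-cell (proj₁ (proj₂ (cover (to (from y)))))
          (proj₂ (proj₂ (cover (to (from y))))) (unresize (strictlyInverseˡ y))

      transversal-in : Finite (cosetsIn stabilizer S) →
        ∃[ A ] (family A × (∀ {P} → Cell P → AtMostOne (P ∩ A)))
      transversal-in (n , indexing) =
        let i , Aᵢ∈ = finite-cover 𝒰 n A (proj₂ inhabited) covering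
        in A i , Aᵢ∈ , λ P-cell (y∈P , lift y∈A) (z∈P , lift z∈A) →
          thin (resize (cell-quotient P-cell y∈P z∈P)) y∈A z∈A
        where
        open Inverse indexing using (to; from; strictlyInverseˡ)
        open Setoid (cosets stabilizer) using () renaming (_≈_ to _∼ᵀ_)

        quotient-map : Surjection setoid (cosets stabilizer)
        quotient-map = record
          { to         = id
          ; cong       = ≈⇒∼ stabilizer
          ; surjective = λ y → y , ≈⇒∼ stabilizer
          }

        section-func = proj₁ (choice _ _ _ _ setoid (cosets stabilizer) quotient-map)

        open Func section-func renaming (to to representative; cong to representative-cong)

        representative-∼ : ∀ y → representative y ∼ᵀ y
        representative-∼ = proj₂ (choice _ _ _ _ setoid (cosets stabilizer) quotient-map)

        -- The position of y in its coset of T, an element of T; it depends on y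
        -- only modulo S because representatives are chosen in G rather than in G/S.
        part : Carrier → Carrier
        part y = representative y ⁻¹ ∙ y

        -- One set for each coset of `S` in the stabilizer: the points whose position in their cell
        -- is that coset.
        A : Fin n → Subset space
        A i = record
          { mem  = λ y → Lift (c ⊔ p) (proj₁ (to i) ∼ part y)
          ; resp = λ y∼z (lift i∼y) → lift (∼-trans i∼y
              (·-cong (⁻¹-cong (representative-cong (S≤stabilizer y∼z))) y∼z))
          }

        covering : ∀ {y} → y ∈ proj₁ inhabited → ∃[ i ] y ∈ A i
        covering {y} _ =
          from (part y , representative-∼ y) , lift (strictlyInverseˡ (part y , representative-∼ y))

        -- Points of one cell share a representative up to `≈`, and cancelling its inverse recovers
        -- the point modulo `S` from its position.
        thin : ∀ {i y z} → y ∼ᵀ z → proj₁ (to i) ∼ part y → proj₁ (to i) ∼ part z → y ∼ z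
        thin {i} {y} {z} y∼z i∼y i∼z = ∼-∙ˡ⁻ S (representative y ⁻¹)
          (∼-trans (∼-sym i∼y) (∼-trans i∼z
            (·-cong (⁻¹-cong (sym (representative-cong y∼z))) ∼-refl)))

theorem2 : (∀ ℓ → ExcludedMiddle ℓ) →
    (∀ a ℓ₁ b ℓ₂ → Choice a ℓ₁ b ℓ₂) →
    ∀ {c ℓ p : Level} (G : Group c ℓ) (S : Subgroup G p) →
    Infinite (cosets S) →
    let open TransitiveGSpace (cosetSpace S) in
    (∀ (𝒰 : Ultrafilter space) → Free 𝒰 → Selective 𝒰)
    ⇔
    (∀ (T : Subgroup G p) → S ≤ T → Finite (cosetsIn T S) ⊎ Finite (cosets T))
theorem2 em choice G S _ = mk⇔ finite-index selective
  where
  open TransitiveGSpace (cosetSpace S)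

  finite-index : (∀ (𝒰 : Ultrafilter space) → Free 𝒰 → Selective 𝒰) →
    ∀ (T : Subgroup G _) → S ≤ T → Finite (cosetsIn T S) ⊎ Finite (cosets T)
  finite-index all-selective T S≤T with em _ {Finite (cosetsIn T S)} | em _ {Finite (cosets T)}
  ... | yes T/S-finite | _              = inj₁ T/S-finite
  ... | no _           | yes G/T-finite = inj₂ G/T-finite
  ... | no T/S-infinite | no G/T-infinite = contradiction all-selective
    (InfiniteIndices.nonselective em choice S T S≤T T/S-infinite G/T-infinite)

  selective : (∀ (T : Subgroup G _) → S ≤ T → Finite (cosetsIn T S) ⊎ Finite (cosets T)) →
    ∀ (𝒰 : Ultrafilter space) → Free 𝒰 → Selective 𝒰
  selective finite-indices 𝒰 _ 𝒫 invariant with finite-indices stabilizer S≤stabilizer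
    where open FiniteIndices em choice S 𝒫 invariant
  ... | inj₁ T/S-finite = inj₂ (FiniteIndices.transversal-in em choice S 𝒫 invariant 𝒰 T/S-finite)
  ... | inj₂ G/T-finite = inj₁ (FiniteIndices.cell-in em choice S 𝒫 invariant 𝒰 G/T-finite)
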